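{- Let $v\ge4$ be an integer with $v\not\equiv2\pmod 4$. Then an optimum $(d,2)$-CDA$((d+1)v^2;5,v)$ exists for every positive integer $d$ with $d+1\le v$.
   Context: Consecutive $t$-way interaction in an $N\times k$ array $A=(a_{ij})$ over a $v$-set $V$: $T=\{(i,x_i),\dots,(i+t-1,x_{i+t-1})\}$, $1\le i\le k-t+1$, $x_r\in V$; $\rho(A,T)=\{r: a_{r,j}=x_j\ \forall (j,x_j)\in T\}$, $\rho(A,\mathcal T)=\bigcup_{T\in\mathcal T}\rho(A,T)$. A $(d,t)$-CDA$(N;k,v)$ is an $N\times k$ array over $V$ in which every $t$ consecutive columns contain every $t$-tuple at least once, and such that for every set $\mathcal T$ of exactly $d$ distinct consecutive $t$-way interactions and every consecutive $t$-way interaction $T$: $\rho(A,T)\subseteq\rho(A,\mathcal T)$ iff $T\in\mathcal T$. It is optimum if $N=(d+1)v^t$. -}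

module Defs where

open import Data.Fin using (Fin; toℕ; fromℕ<)
open import Data.Fin.Properties using (toℕ<n)
open import Data.Nat using (ℕ; _+_; _*_; _^_; _≤_)
open import Data.Nat.Properties using (<-≤-trans; +-monoʳ-<)
open import Data.Product using (∃-syntax)
open import Data.Vec using (Vec; lookup)
open import Data.Vec.Membership.Propositional using () renaming (_∈_ to _∈ᵥ_)
open import Data.Vec.Relation.Unary.Any using (Any)
open import Data.Vec.Relation.Unary.Unique.Propositional using (Unique)
open import Function.Bundles using (_⇔_)
open import Level using (0ℓ)
open import Relation.Binary.PropositionalEquality using (_≡_)
open import Relation.Unary using (Pred; _∈_; _⊆_)

-- The v-set of symbols is Fin v; rows and columns are numbered from 0.
Array : ℕ → ℕ → ℕ → Set
Array N k v = Fin N → Fin k → Fin v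

-- The interaction {(start + c , lookup values c) | c < t}.  Because `fits` is
-- irrelevant, _≡_ compares only start and values; for t ≥ 1 this is equality
-- of the underlying sets of pairs.
record Interaction (t k v : ℕ) : Set where
  constructor interaction
  field
    start  : ℕ
    .fits  : start + t ≤ k
    values : Vec (Fin v) t

open Interaction public using (start; values)

column : ∀ {t k v} → Interaction t k v → Fin t → Fin k
column (interaction i fits _) c =
  fromℕ< {i + toℕ c} (<-≤-trans (+-monoʳ-< i (toℕ<n c)) fits)

ρ : ∀ {t N k v} → Array N k v → Interaction t k v → Pred (Fin N) 0ℓ
ρ A T r = ∀ c → A r (column T c) ≡ lookup (values T) c

ρ⋃ : ∀ {t N k v d} → Array N k v → Vec (Interaction t k v) d → Pred (Fin N) 0ℓ
ρ⋃ A 𝒯 r = Any (λ T → r ∈ ρ A T) 𝒯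

-- A set of exactly d interactions is given by a repetition-free vector of length d.
record IsCDA (d t : ℕ) {N k v : ℕ} (A : Array N k v) : Set where
  field
    covers  : (T : Interaction t k v) → ∃[ r ] r ∈ ρ A T
    detects : (𝒯 : Vec (Interaction t k v) d) → Unique 𝒯 →
              (T : Interaction t k v) → (ρ A T ⊆ ρ⋃ A 𝒯) ⇔ (T ∈ᵥ 𝒯)

record CDA (d t N k v : ℕ) : Set where
  field
    array : Array N k v
    isCDA : IsCDA d t array

IsOptimum : ∀ {d t N k v} → CDA d t N k v → Set
IsOptimum {d} {t} {N} {k} {v} _ = N ≡ (d + 1) * v ^ t

{-# OPTIONS --safe #-}
module Submission where

-- If every interaction T has d + 1 rows and two different interactions share
-- at most one row, then d interactions other than T cannot cover all rows of T,
-- so the array is a CDA.  Such an array with five columns has, for every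
-- x, y in ℤ/v and every s in a set of d + 1 residues, the row
--   (x , y , x + s , y + s , x + 2s).
-- For fixed s, each pair of adjacent columns takes each pair of values exactly once,
-- and the row is determined by any union of two pairs of adjacent columns.

open import Defs
open import Data.Empty using (⊥-elim-irr)
open import Data.Fin using (Fin; toℕ; fromℕ<; inject≤; combine; remQuot)
open import Data.Fin.Patterns
open import Data.Fin.Properties using (toℕ<n; toℕ-fromℕ<; toℕ-injective; pigeonhole; inject≤-injective; combine-injectiveˡ; combine-injective; combine-remQuot) renaming (_≟_ to _≟ᶠ_; <⇒≢ to <⇒≢ᶠ)
open import Data.Nat using (ℕ; zero; suc; _+_; _*_; _^_; _≤_; _<_; _∸_; z≤n; s≤s; NonZero)
open import Data.Nat.DivMod using (_%_; _mod_; m%n<n; m%n%n≡m%n; %-distribˡ-+; [m+n]%n≡m%n; m<n⇒m%n≡m)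
open import Data.Nat.Properties using (_≟_; +-assoc; +-comm; +-cancelʳ-≤; m+[n∸m]≡n; m∸n+n≡m; m<m+n; <⇒≤; <-cmp)
open import Data.Product using (Σ-syntax; _×_; _,_; proj₁; proj₂)
open import Data.Vec using (Vec; lookup; _∷_; [])
open import Data.Vec.Membership.Propositional using () renaming (_∈_ to _∈ᵥ_)
open import Data.Vec.Membership.Propositional.Properties using (∈-lookup)
open import Data.Vec.Properties using (≡-dec; tabulate-cong; tabulate∘lookup)
open import Data.Vec.Relation.Unary.Any using (index; map)
open import Data.Vec.Relation.Unary.Any.Properties using (lookup-index)
open import Function.Bundles using (mk⇔)
open import Relation.Binary.Definitions using (DecidableEquality; tri<; tri≈; tri>)
open import Relation.Binary.PropositionalEquality using (_≡_; _≢_; refl; sym; trans; cong; cong₂; subst; module ≡-Reasoning)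
open import Relation.Nullary using (¬_; yes; no; contradiction)
open import Relation.Nullary.Decidable using (map′; _×-dec_)
open import Relation.Unary using (_∈_; _⊆_)
import Data.Vec.Membership.DecPropositional as DecMembership

-- Interactions and a counting criterion for a CDA.

private
  variable
    t N k v d : ℕ

lookup-extensional : {A : Set} {n : ℕ} {xs ys : Vec A n} →
  (∀ i → lookup xs i ≡ lookup ys i) → xs ≡ ys
lookup-extensional {xs = xs} {ys} eq =
  trans (sym (tabulate∘lookup xs)) (trans (tabulate-cong eq) (tabulate∘lookup ys))

interaction-≡ : {T T′ : Interaction t k v} →
  start T ≡ start T′ → values T ≡ values T′ → T ≡ T′
interaction-≡ {T = interaction _ _ _} {T′ = interaction _ _ _} refl refl = refl

_≟ᴵ_ : DecidableEquality (Interaction t k v)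
T ≟ᴵ T′ = map′
  (λ (eqₛ , eqᵥ) → interaction-≡ eqₛ eqᵥ)
  (λ eq → cong start eq , cong values eq)
  (start T ≟ start T′ ×-dec ≡-dec _≟ᶠ_ (values T) (values T′))

-- A row has a single value in each column. This leaves only interactions with different starts to
-- be compared in `separating`.
same-start-disjoint : (A : Array N k v) {T T′ : Interaction t k v} {r : Fin N} →
  start T ≡ start T′ → r ∈ ρ A T → r ∈ ρ A T′ → T ≡ T′
same-start-disjoint A {interaction _ _ _} {interaction _ _ _} refl r∈T r∈T′ =
  interaction-≡ refl (lookup-extensional (λ c → trans (sym (r∈T c)) (r∈T′ c)))

isCDA-if-separating : (A : Array N k v) (row : Interaction t k v → Fin (d + 1) → Fin N) →
  (∀ T s → row T s ∈ ρ A T) →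
  (∀ T {s s′} → row T s ≡ row T s′ → s ≡ s′) →
  (∀ T T′ r r′ → T ≢ T′ → r ∈ ρ A T → r′ ∈ ρ A T → r ∈ ρ A T′ → r′ ∈ ρ A T′ → r ≡ r′) →
  IsCDA d t A
isCDA-if-separating {N} {k} {v} {t} {d} A row row∈ρ row-injective separating = record
  { covers  = λ T → row T s₀ , row∈ρ T s₀
  ; detects = λ 𝒯 _ T → mk⇔ (covered⇒member 𝒯 T) (λ T∈𝒯 r∈T → map (λ { refl → r∈T }) T∈𝒯)
  }
  where
  open DecMembership (_≟ᴵ_ {t} {k} {v}) using (_∈?_)

  d<d+1 : d < d + 1
  d<d+1 = m<m+n d (s≤s z≤n)

  s₀ : Fin (d + 1)
  s₀ = fromℕ< d<d+1

  covered⇒member : (𝒯 : Vec (Interaction t k v) d) (T : Interaction t k v) →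
    ρ A T ⊆ ρ⋃ A 𝒯 → T ∈ᵥ 𝒯
  covered⇒member 𝒯 T ρ⊆ with T ∈? 𝒯
  ... | yes T∈𝒯 = T∈𝒯
  -- Each of the `d + 1` chosen rows of `T` lies in some member of `𝒯`, which has only `d`
  -- positions, so one position serves two rows. Its member differs from `T`, and `separating` then
  -- makes the two rows equal.
  ... | no  T∉𝒯 with pigeonhole d<d+1 (λ s → index (ρ⊆ (row∈ρ T s)))
  ... | s , s′ , s<s′ , same = contradiction (row-injective T rows≡) (<⇒≢ᶠ s<s′)
    where
    hit : ∀ s → row T s ∈ ρ A (lookup 𝒯 (index (ρ⊆ (row∈ρ T s))))
    hit s = lookup-index (ρ⊆ (row∈ρ T s))

    T′ : Interaction t k v
    T′ = lookup 𝒯 (index (ρ⊆ (row∈ρ T s)))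

    T≢T′ : T ≢ T′
    T≢T′ eq = T∉𝒯 (subst (_∈ᵥ 𝒯) (sym eq) (∈-lookup _ 𝒯))

    rows≡ : row T s ≡ row T s′
    rows≡ = separating T T′ _ _ T≢T′ (row∈ρ T s) (row∈ρ T s′) (hit s)
      (subst (λ i → row T s′ ∈ ρ A (lookup 𝒯 i)) (sym same) (hit s′))

-- Arithmetic of residues modulo `v`.

module _ {v : ℕ} .{{_ : NonZero v}} where

  infixl 6 _⊕_ _⊖_

  -- `⊖` adds the complement `v ∸ toℕ y`, never truncated since `toℕ y < v`; the plain
  -- `toℕ x ∸ toℕ y` would lose the wrap-around.
  _⊕_ _⊖_ : Fin v → Fin v → Fin v
  x ⊕ y = (toℕ x + toℕ y) mod v
  x ⊖ y = (toℕ x + (v ∸ toℕ y)) mod v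

  toℕ-mod : ∀ m → toℕ (m mod v) ≡ m % v
  toℕ-mod m = toℕ-fromℕ< (m%n<n m v)

  %-+-absorbˡ : ∀ m n → (m % v + n) % v ≡ (m + n) % v
  %-+-absorbˡ m n = begin
    (m % v + n) % v           ≡⟨ %-distribˡ-+ (m % v) n v ⟩
    (m % v % v + n % v) % v   ≡⟨ cong (λ h → (h + n % v) % v) (m%n%n≡m%n m v) ⟩
    (m % v + n % v) % v       ≡⟨ %-distribˡ-+ m n v ⟨
    (m + n) % v               ∎
    where open ≡-Reasoning

  -- The two shifts make one full turn, which vanishes modulo `v`. Leaving `a` and `b` general
  -- serves both `⊕-⊖` and `⊖-⊕`.
  shift-unshift : ∀ (x : Fin v) {a b} → a + b ≡ v →
    (toℕ ((toℕ x + a) mod v) + b) mod v ≡ x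
  shift-unshift x {a} {b} a+b≡v = toℕ-injective (begin
    toℕ ((toℕ ((toℕ x + a) mod v) + b) mod v)  ≡⟨ toℕ-mod _ ⟩
    (toℕ ((toℕ x + a) mod v) + b) % v          ≡⟨ cong (λ h → (h + b) % v) (toℕ-mod _) ⟩
    ((toℕ x + a) % v + b) % v                  ≡⟨ %-+-absorbˡ (toℕ x + a) b ⟩
    (toℕ x + a + b) % v                        ≡⟨ cong (_% v) (+-assoc (toℕ x) a b) ⟩
    (toℕ x + (a + b)) % v                      ≡⟨ cong (λ h → (toℕ x + h) % v) a+b≡v ⟩
    (toℕ x + v) % v                            ≡⟨ [m+n]%n≡m%n (toℕ x) v ⟩
    toℕ x % v                                  ≡⟨ m<n⇒m%n≡m (toℕ<n x) ⟩
    toℕ x                                      ∎)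
    where open ≡-Reasoning

  ⊕-⊖ : ∀ x s → (x ⊕ s) ⊖ s ≡ x
  ⊕-⊖ x s = shift-unshift x (m+[n∸m]≡n (<⇒≤ (toℕ<n s)))

  ⊖-⊕ : ∀ x s → (x ⊖ s) ⊕ s ≡ x
  ⊖-⊕ x s = shift-unshift x (m∸n+n≡m (<⇒≤ (toℕ<n s)))

  ⊕-comm : ∀ x s → x ⊕ s ≡ s ⊕ x
  ⊕-comm x s = cong (_mod v) (+-comm (toℕ x) (toℕ s))

  -- With `s ≡ s′` as a hypothesis, equations between entries of two rows can be used directly.
  ⊕-cancelʳ : ∀ {x x′ s s′} → s ≡ s′ → x ⊕ s ≡ x′ ⊕ s′ → x ≡ x′
  ⊕-cancelʳ {x} {x′} {s} refl eq =
    trans (sym (⊕-⊖ x s)) (trans (cong (_⊖ s) eq) (⊕-⊖ x′ s))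

  ⊕-cancelˡ : ∀ {x x′ s s′} → x ≡ x′ → x ⊕ s ≡ x′ ⊕ s′ → s ≡ s′
  ⊕-cancelˡ {x} {x′} {s} {s′} x≡x′ eq =
    ⊕-cancelʳ x≡x′ (trans (⊕-comm s x) (trans eq (⊕-comm x′ s′)))

  -- The five columns and what determines a row.

  Parameters : Set
  Parameters = Fin v × Fin v × Fin v

  -- Column 4 is column 2 shifted once more, so columns two apart always differ by `s` and nothing
  -- has to be halved.
  entry : Parameters → Fin 5 → Fin v
  entry (s , x , y) 0F = x
  entry (s , x , y) 1F = y
  entry (s , x , y) 2F = x ⊕ s
  entry (s , x , y) 3F = y ⊕ s
  entry (s , x , y) 4F = x ⊕ s ⊕ s

  parameters-≡ : ∀ {s s′ x x′ y y′ : Fin v} →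
    s ≡ s′ → x ≡ x′ → y ≡ y′ → (s , x , y) ≡ (s′ , x′ , y′)
  parameters-≡ refl refl refl = refl

  Agree : Parameters → Parameters → Fin 5 → Set
  Agree p q j = entry p j ≡ entry q j

  -- Here and in the next three lemmas the triple contains two columns two apart. Their difference
  -- gives `s`, and undoing the shifts gives `x` and `y`.
  agree₀₁₂ : ∀ p q → Agree p q 0F → Agree p q 1F → Agree p q 2F → p ≡ q
  agree₀₁₂ _ _ e₀ e₁ e₂ = parameters-≡ (⊕-cancelˡ e₀ e₂) e₀ e₁

  agree₀₁₃ : ∀ p q → Agree p q 0F → Agree p q 1F → Agree p q 3F → p ≡ q
  agree₀₁₃ _ _ e₀ e₁ e₃ = parameters-≡ (⊕-cancelˡ e₁ e₃) e₀ e₁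

  agree₁₂₃ : ∀ p q → Agree p q 1F → Agree p q 2F → Agree p q 3F → p ≡ q
  agree₁₂₃ _ _ e₁ e₂ e₃ = parameters-≡ s≡ (⊕-cancelʳ s≡ e₂) e₁
    where s≡ = ⊕-cancelˡ e₁ e₃

  agree₂₃₄ : ∀ p q → Agree p q 2F → Agree p q 3F → Agree p q 4F → p ≡ q
  agree₂₃₄ _ _ e₂ e₃ e₄ = parameters-≡ s≡ (⊕-cancelʳ s≡ e₂) (⊕-cancelʳ s≡ e₃)
    where s≡ = ⊕-cancelˡ e₂ e₄

  -- The field `fits` is irrelevant, so its contradiction is usable only through `⊥-elim-irr`; the
  -- starts 0 to 3 remain.
  start≱4 : ∀ i → ¬ (4 + i + 2 ≤ 5)
  start≱4 i fits with +-cancelʳ-≤ 2 (4 + i) 3 fits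
  ... | s≤s (s≤s (s≤s ()))

  -- Two windows with different starts cover at least three columns, and in all six cases these
  -- include one of the four triples above. Ordering the starts avoids the mirrored cases.
  agree-on-two-interactions : ∀ p q (T T′ : Interaction 2 5 v) → start T < start T′ →
    (∀ c → Agree p q (column T c)) → (∀ c → Agree p q (column T′ c)) → p ≡ q
  agree-on-two-interactions p q (interaction 0 _ _) (interaction 1 _ _) _ e e′ =
    agree₀₁₂ p q (e 0F) (e 1F) (e′ 1F)
  agree-on-two-interactions p q (interaction 0 _ _) (interaction 2 _ _) _ e e′ =
    agree₀₁₂ p q (e 0F) (e 1F) (e′ 0F)
  agree-on-two-interactions p q (interaction 0 _ _) (interaction 3 _ _) _ e e′ =
    agree₀₁₃ p q (e 0F) (e 1F) (e′ 0F)
  agree-on-two-interactions p q (interaction 1 _ _) (interaction 2 _ _) _ e e′ =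
    agree₁₂₃ p q (e 0F) (e 1F) (e′ 1F)
  agree-on-two-interactions p q (interaction 1 _ _) (interaction 3 _ _) _ e e′ =
    agree₁₂₃ p q (e 0F) (e 1F) (e′ 0F)
  agree-on-two-interactions p q (interaction 2 _ _) (interaction 3 _ _) _ e e′ =
    agree₂₃₄ p q (e 0F) (e 1F) (e′ 1F)
  agree-on-two-interactions _ _ (interaction (suc _) _ _) (interaction 1 _ _) (s≤s ())
  agree-on-two-interactions _ _ (interaction (suc (suc _)) _ _) (interaction 2 _ _) (s≤s (s≤s ()))
  agree-on-two-interactions _ _ (interaction (suc (suc (suc _))) _ _) (interaction 3 _ _) (s≤s (s≤s (s≤s ())))
  agree-on-two-interactions _ _ _ (interaction (suc (suc (suc (suc i)))) fits _) _ _ _ =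
    ⊥-elim-irr (start≱4 i fits)

  -- Windows with an odd start meet a `y` column first, hence the exchanged order of `a` and `b`.
  -- Each shift in `entry` is undone by one `⊖ s`.
  solve : Interaction 2 5 v → Fin v → Fin v × Fin v
  solve (interaction 0 _ (a ∷ b ∷ [])) s = a , b
  solve (interaction 1 _ (a ∷ b ∷ [])) s = b ⊖ s , a
  solve (interaction 2 _ (a ∷ b ∷ [])) s = a ⊖ s , b ⊖ s
  solve (interaction 3 _ (a ∷ b ∷ [])) s = b ⊖ s ⊖ s , a ⊖ s
  solve (interaction (suc (suc (suc (suc i)))) fits _) s = ⊥-elim-irr (start≱4 i fits)

  entry-solve : ∀ T s c → entry (s , solve T s) (column T c) ≡ lookup (values T) c
  entry-solve (interaction 0 _ (a ∷ b ∷ [])) s 0F = refl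
  entry-solve (interaction 0 _ (a ∷ b ∷ [])) s 1F = refl
  entry-solve (interaction 1 _ (a ∷ b ∷ [])) s 0F = refl
  entry-solve (interaction 1 _ (a ∷ b ∷ [])) s 1F = ⊖-⊕ b s
  entry-solve (interaction 2 _ (a ∷ b ∷ [])) s 0F = ⊖-⊕ a s
  entry-solve (interaction 2 _ (a ∷ b ∷ [])) s 1F = ⊖-⊕ b s
  entry-solve (interaction 3 _ (a ∷ b ∷ [])) s 0F = ⊖-⊕ a s
  entry-solve (interaction 3 _ (a ∷ b ∷ [])) s 1F = trans (cong (_⊕ s) (⊖-⊕ (b ⊖ s) s)) (⊖-⊕ b s)
  entry-solve (interaction (suc (suc (suc (suc i)))) fits _) s _ = ⊥-elim-irr (start≱4 i fits)

  -- Numbering the rows and assembling the array.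

  module _ {n : ℕ} (n≤v : n ≤ v) where

    -- `v ^ 2` unfolds to `v * (v * 1)`, so the last digit lives in `Fin 1`. Keeping this form lets
    -- `IsOptimum` hold by `refl`.
    encode : Fin n → Fin v × Fin v → Fin (n * v ^ 2)
    encode s (x , y) = combine s (combine x (combine y 0F))

    decode : Fin (n * v ^ 2) → Fin n × Fin v × Fin v
    decode r =
      let s , r₁ = remQuot {n} (v ^ 2) r
          x , r₂ = remQuot {v} (v ^ 1) r₁
          y , _  = remQuot {v} 1 r₂
      in s , x , y

    encode-decode : ∀ r → encode (proj₁ (decode r)) (proj₂ (decode r)) ≡ r
    encode-decode r = begin
      -- `decode` drops the last digit, which can only be `0F`.
      combine s (combine x (combine y 0F))   ≡⟨ cong (λ z → combine s (combine x (combine y z))) (Fin1-≡ z) ⟩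
      combine s (combine x (combine y z))    ≡⟨ cong (λ r₂ → combine s (combine x r₂)) (combine-remQuot {v} 1 r₂) ⟩
      combine s (combine x r₂)               ≡⟨ cong (combine s) (combine-remQuot {v} (v ^ 1) r₁) ⟩
      combine s r₁                           ≡⟨ combine-remQuot {n} (v ^ 2) r ⟩
      r                                      ∎
      where
      open ≡-Reasoning
      s  = proj₁ (remQuot {n} (v ^ 2) r)
      r₁ = proj₂ (remQuot {n} (v ^ 2) r)
      x  = proj₁ (remQuot {v} (v ^ 1) r₁)
      r₂ = proj₂ (remQuot {v} (v ^ 1) r₁)
      y  = proj₁ (remQuot {v} 1 r₂)
      z  = proj₂ (remQuot {v} 1 r₂)
      Fin1-≡ : ∀ (z : Fin 1) → 0F ≡ z
      Fin1-≡ 0F = refl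

    encode-injective : ∀ s s′ xy xy′ → encode s xy ≡ encode s′ xy′ → (s , xy) ≡ (s′ , xy′)
    encode-injective s s′ (x , y) (x′ , y′) eq
      with refl , eq₁ ← combine-injective s _ s′ _ eq
      with refl , eq₂ ← combine-injective x (combine y 0F) x′ (combine y′ 0F) eq₁
      with refl ← combine-injectiveˡ y 0F y′ 0F eq₂ = refl

    -- An injective map with a right inverse has it as a two-sided inverse.
    decode-encode : ∀ s xy → decode (encode s xy) ≡ (s , xy)
    decode-encode s xy = encode-injective _ s _ xy (encode-decode (encode s xy))

    -- The set of shifts is taken to be the residues 0 to `n - 1`, distinct because `n ≤ v`.
    parameters : Fin n × Fin v × Fin v → Parameters
    parameters (s , xy) = inject≤ s n≤v , xy

    parameters-injective : ∀ {a b} → parameters a ≡ parameters b → a ≡ b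
    parameters-injective eq =
      cong₂ _,_ (inject≤-injective n≤v n≤v _ _ (cong proj₁ eq)) (cong proj₂ eq)

    decode-injective : ∀ {r r′} → decode r ≡ decode r′ → r ≡ r′
    decode-injective {r} {r′} eq = begin
      r                                                ≡⟨ encode-decode r ⟨
      encode (proj₁ (decode r)) (proj₂ (decode r))     ≡⟨ cong (λ a → encode (proj₁ a) (proj₂ a)) eq ⟩
      encode (proj₁ (decode r′)) (proj₂ (decode r′))   ≡⟨ encode-decode r′ ⟩
      r′                                               ∎
      where open ≡-Reasoning

    cyclicArray : Array (n * v ^ 2) 5 v
    cyclicArray r = entry (parameters (decode r))

    row : Interaction 2 5 v → Fin n → Fin (n * v ^ 2)
    row T s = encode s (solve T (inject≤ s n≤v))

    row∈ρ : ∀ T s → row T s ∈ ρ cyclicArray T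
    row∈ρ T s c = trans
      (cong (λ a → entry (parameters a) (column T c)) (decode-encode s _))
      (entry-solve T (inject≤ s n≤v) c)

    -- The shift is the leading digit of the row number.
    row-injective : ∀ T {s s′} → row T s ≡ row T s′ → s ≡ s′
    row-injective T {s} {s′} eq = combine-injectiveˡ s _ s′ _ eq

    separating : ∀ T T′ r r′ → T ≢ T′ →
      r ∈ ρ cyclicArray T → r′ ∈ ρ cyclicArray T →
      r ∈ ρ cyclicArray T′ → r′ ∈ ρ cyclicArray T′ → r ≡ r′
    separating T T′ r r′ T≢T′ r∈T r′∈T r∈T′ r′∈T′ with <-cmp (start T) (start T′)
    ... | tri≈ _ same _ = contradiction (same-start-disjoint cyclicArray same r∈T r∈T′) T≢T′
    -- Both rows carry the values of `T` and of `T′`, so they agree on both windows.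
    ... | tri< T<T′ _ _ = decode-injective (parameters-injective
      (agree-on-two-interactions _ _ T T′ T<T′
        (λ c → trans (r∈T c) (sym (r′∈T c))) (λ c → trans (r∈T′ c) (sym (r′∈T′ c)))))
    ... | tri> _ _ T′<T = decode-injective (parameters-injective
      (agree-on-two-interactions _ _ T′ T T′<T
        (λ c → trans (r∈T′ c) (sym (r′∈T′ c))) (λ c → trans (r∈T c) (sym (r′∈T c)))))

mainTheorem17 : (v : ℕ) → 4 ≤ v → v % 4 ≢ 2 →
    (d : ℕ) → 1 ≤ d → d + 1 ≤ v →
    Σ[ C ∈ CDA d 2 ((d + 1) * v ^ 2) 5 v ] IsOptimum C
-- Once `v` is a successor, the `NonZero` instance for reduction modulo `v` is found; the number of
-- shifts is `n = d + 1`.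
mainTheorem17 zero ()
mainTheorem17 (suc _) _ _ d _ d+1≤v = record
  { array = cyclicArray d+1≤v
  ; isCDA = isCDA-if-separating (cyclicArray d+1≤v) (row d+1≤v) (row∈ρ d+1≤v)
      (row-injective d+1≤v) (separating d+1≤v)
  } , refl
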